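{- Let ${\bf u}\in\mathcal A^{\mathbb N}$ have its language closed under reversal. If $D({\bf u})<+\infty$, then there exists an integer $K$ such that every bispecial factor $w$ of ${\bf u}$ with $|w|\ge K$ satisfies $m(w)=0$ if $w\ne\widetilde w$, and $m(w)=\#E^=(w)-1$ if $w=\widetilde w$.
   Context: $\widetilde w$ is the reversal of $w$. Palindromic defect: for a finite word $w$ of length $n$, $D(w)=n+1-$(number of distinct palindromic factors of $w$, including the empty word), and $D({\bf u})=\sup D(w)$ over factors of ${\bf u}$. The language is closed under reversal if the reversal of every factor is a factor. For a factor $w$: $E^+(w)=\{b: wb\text{ factor}\}$, $E^-(w)=\{a: aw\text{ factor}\}$, $E(w)=\{(a,b): awb\text{ factor}\}$, $E^=(w)=\{a: awa\text{ factor}\}$, $m(w)=\#E(w)-\#E^+(w)-\#E^-(w)+1$. A factor is bispecial if $\#E^-(w)\ge2$ and $\#E^+(w)\ge 2$. -}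

module Defs where

open import Level using (0ℓ)
open import Axiom.ExcludedMiddle using (ExcludedMiddle)
open import Data.Nat using (ℕ; suc; _+_)
import Data.Nat as ℕ
open import Data.Integer using (ℤ; +_; _-_; _≤_)
import Data.Integer as ℤ
open import Data.Fin using (Fin)
import Data.Fin as Fin
open import Data.List using (List; []; _∷_; _∷ʳ_; length; filter; reverse; concatMap; inits; tails; deduplicate; applyUpTo; allFin; cartesianProduct)
open import Data.List.Properties using (≡-dec)
open import Data.Product using (_×_; _,_; ∃-syntax)
open import Relation.Binary.Definitions using (DecidableEquality)
open import Relation.Binary.PropositionalEquality using (_≡_)
open import Relation.Unary using (Pred; Decidable)

-- Words over a finite alphabet of k letters.

Word : ℕ → Set
Word k = List (Fin k)

InfWord : ℕ → Set
InfWord k = ℕ → Fin k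

_≟ʷ_ : ∀ {k} → DecidableEquality (Word k)
_≟ʷ_ = ≡-dec Fin._≟_

Palindrome : ∀ {k} → Pred (Word k) 0ℓ
Palindrome w = w ≡ reverse w

palindrome? : ∀ {k} → Decidable (Palindrome {k})
palindrome? w = w ≟ʷ reverse w

Factor : ∀ {k} → InfWord k → Pred (Word k) 0ℓ
Factor u w = ∃[ i ] w ≡ applyUpTo (λ j → u (i + j)) (length w)

ClosedUnderReversal : ∀ {k} → InfWord k → Set
ClosedUnderReversal u = ∀ w → Factor u w → Factor u (reverse w)

-- The list has repetitions; they are removed in palindromicFactors.
factors : ∀ {k} → Word k → List (Word k)
factors w = concatMap inits (tails w)

palindromicFactors : ∀ {k} → Word k → List (Word k)
palindromicFactors w = deduplicate _≟ʷ_ (filter palindrome? (factors w))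

defect : ∀ {k} → Word k → ℤ
defect w = + suc (length w) - + length (palindromicFactors w)

BoundsDefects : ∀ {k} → InfWord k → ℤ → Set
BoundsDefects u d = ∀ w → Factor u w → defect w ≤ d

-- D(u) = d, where D(u) is the supremum of the defects of the factors of u.
HasDefect : ∀ {k} → InfWord k → ℤ → Set
HasDefect u d = BoundsDefects u d × (∀ e → BoundsDefects u e → d ≤ e)

FiniteDefect : ∀ {k} → InfWord k → Set
FiniteDefect u = ∃[ d ] HasDefect u d

module _ {k : ℕ} (u : InfWord k) (w : Word k) where

  E⁺ : Pred (Fin k) 0ℓ
  E⁺ b = Factor u (w ∷ʳ b)

  E⁻ : Pred (Fin k) 0ℓ
  E⁻ a = Factor u (a ∷ w)

  E : Pred (Fin k × Fin k) 0ℓ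
  E (a , b) = Factor u (a ∷ (w ∷ʳ b))

  E⁼ : Pred (Fin k) 0ℓ
  E⁼ a = E (a , a)

-- Being a factor of an infinite word is not decidable constructively, so
-- cardinalities of sets of extensions are taken relative to excluded middle.
module _ (em : ExcludedMiddle 0ℓ) where

  -- The number of elements of P, for xs enumerating A without repetition.
  card : {A : Set} → List A → Pred A 0ℓ → ℕ
  card xs P = length (filter (λ x → em {P x}) xs)

  module _ {k : ℕ} (u : InfWord k) (w : Word k) where

    #E⁺ #E⁻ #E⁼ #E : ℕ
    #E⁺ = card (allFin k) (E⁺ u w)
    #E⁻ = card (allFin k) (E⁻ u w)
    #E⁼ = card (allFin k) (E⁼ u w)
    #E  = card (cartesianProduct (allFin k) (allFin k)) (E u w)

    -- The bilateral multiplicity m(w).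
    m : ℤ
    m = + #E - + #E⁺ - + #E⁻ ℤ.+ + 1

    Bispecial : Set
    Bispecial = Factor u w × 2 ℕ.≤ #E⁻ × 2 ℕ.≤ #E⁺

{-# OPTIONS --safe #-}
module Submission where

open import Level using (0ℓ)
open import Axiom.ExcludedMiddle using (ExcludedMiddle)
open import Data.Nat using (ℕ; zero; suc; _+_; _≤_; _<_; _≥_; z≤n; s≤s; s≤s⁻¹)
open import Data.Nat.Properties
open import Data.Nat.Tactic.RingSolver using (solve)
import Data.Integer as ℤ
import Data.Integer.Properties as ℤₚ
open import Data.Integer using (+_; _-_)
import Data.Integer.Tactic.RingSolver as ℤ-Solver
open import Data.Fin using (Fin)
open import Data.List using (List; []; _∷_; _++_; _∷ʳ_; [_]; length; reverse; applyUpTo; applyDownFrom; inits; tails; filter; allFin; cartesianProduct)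
open import Data.List.Properties using (∷-injective; ∷-injectiveˡ; ∷-injectiveʳ; ∷ʳ-injective; length-++; length-++-sucʳ; length-applyUpTo; applyUpTo-∷ʳ; reverse-++; unfold-reverse; reverse-applyUpTo; reverse-involutive; filter-none; filter-≐)
open import Data.List.Membership.Propositional using (_∈_; find; lose)
open import Data.List.Membership.Propositional.Properties using (∈-map⁺; ∈-map⁻; ∈-++⁺ˡ; ∈-++⁺ʳ; ∈-++⁻; ∈-∃++; ∈-concatMap⁺; ∈-concatMap⁻; ∈-filter⁺; ∈-filter⁻; ∈-deduplicate⁺; ∈-deduplicate⁻; ∈-allFin; ∈-cartesianProduct⁺)
open import Data.List.Relation.Unary.Any using (here; there)
open import Data.List.Relation.Unary.All using (lookup; universal)
open import Data.List.Relation.Unary.AllPairs using ([]; _∷_)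
open import Data.List.Relation.Unary.Unique.Propositional using (Unique)
import Data.List.Relation.Unary.Unique.Propositional.Properties as Uniqueₚ
open import Data.List.Relation.Unary.Unique.DecPropositional.Properties using (deduplicate-!)
open import Data.Product using (_×_; _,_; proj₁; proj₂; ∃-syntax; swap)
open import Data.Sum as Sum using (_⊎_; inj₁; inj₂; [_,_]′)
open import Data.Empty using (⊥; ⊥-elim)
open import Function using (_∘_; id)
open import Relation.Nullary using (¬_; Dec; yes; no; contradiction)
open import Relation.Unary using (Pred; _∪_; ｛_｝; _≐_; _⊆_; ∅)
open import Relation.Binary.Definitions using (tri<; tri≈; tri>)
open import Relation.Binary.PropositionalEquality using (_≡_; _≢_; refl; sym; trans; cong; cong₂; subst; subst₂; module ≡-Reasoning)
open import Defs

-- Finite defect means that, from some length N on, every prefix of u has a palindromic suffix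
-- that did not occur before. Let a block u[i , i + m) ending after N repeat, up to reversal, an
-- earlier block. The new palindrome ending with it cannot lie inside it (it would have occurred
-- in the earlier copy), hence it extends the block to the left, and its reflection exhibits the
-- reversal of the block together with its left neighbour, earlier in u.
--
-- Given a long factor w, form the graph whose vertices are the one-letter extensions of w and
-- whose edges are the words awb, both up to reversal. Reading u from left to right, the
-- successive occurrences of w and of its reversal trace this graph. By the above, each
-- occurrence after the first starts at a known vertex, and it ends at a known vertex only if
-- its edge is known or is a loop. So each new edge other than a loop creates exactly one new
-- vertex and the graph, loops aside, is a tree. Counting edges and vertices of the tree gives
-- m(w): its vertex classes are E⁻(w) and E⁺(w) if w is not a palindrome; if w is a palindrome
-- they coincide, each edge is counted twice in E(w), and the loops are E⁼(w).

-- Lists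

module _ {A : Set} where

  applyUpTo-cong : ∀ {f g : ℕ → A} n → (∀ x → x < n → f x ≡ g x) →
    applyUpTo f n ≡ applyUpTo g n
  applyUpTo-cong zero    eq = refl
  applyUpTo-cong (suc n) eq =
    cong₂ _∷_ (eq 0 (s≤s z≤n)) (applyUpTo-cong n λ x x<n → eq (suc x) (s≤s x<n))

  applyUpTo-injective : ∀ {f g : ℕ → A} n → applyUpTo f n ≡ applyUpTo g n →
    ∀ x → x < n → f x ≡ g x
  applyUpTo-injective (suc n) eq zero    _         = ∷-injectiveˡ eq
  applyUpTo-injective (suc n) eq (suc x) (s≤s x<n) =
    applyUpTo-injective n (∷-injectiveʳ eq) x x<n

  applyUpTo≡applyDownFrom⁺ : ∀ {f g : ℕ → A} n → (∀ x y → suc (x + y) ≡ n → f x ≡ g y) →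
    applyUpTo f n ≡ applyDownFrom g n
  applyUpTo≡applyDownFrom⁺ zero    eq = refl
  applyUpTo≡applyDownFrom⁺ (suc n) eq =
    cong₂ _∷_ (eq 0 n refl) (applyUpTo≡applyDownFrom⁺ n λ x y e → eq (suc x) y (cong suc e))

  applyUpTo≡applyDownFrom⁻ : ∀ {f g : ℕ → A} n → applyUpTo f n ≡ applyDownFrom g n →
    ∀ x y → suc (x + y) ≡ n → f x ≡ g y
  applyUpTo≡applyDownFrom⁻ (suc n) eq zero    .n refl = ∷-injectiveˡ eq
  applyUpTo≡applyDownFrom⁻ (suc n) eq (suc x) y  e    =
    applyUpTo≡applyDownFrom⁻ n (∷-injectiveʳ eq) x y (suc-injective e)

  ∈-inits-applyUpTo⁻ : ∀ (f : ℕ → A) n {v} → v ∈ inits (applyUpTo f n) →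
    ∃[ q ] q ≤ n × v ≡ applyUpTo f q
  ∈-inits-applyUpTo⁻ f n       (here refl) = 0 , z≤n , refl
  ∈-inits-applyUpTo⁻ f (suc n) (there (here refl)) = 1 , s≤s z≤n , refl
  ∈-inits-applyUpTo⁻ f (suc n) (there (there v∈)) with ∈-map⁻ _ v∈
  ... | _ , v′∈ , refl with ∈-inits-applyUpTo⁻ (f ∘ suc) n (there v′∈)
  ... | q , q≤n , refl = suc q , s≤s q≤n , refl

  ∈-inits-applyUpTo⁺ : ∀ (f : ℕ → A) {n q} → q ≤ n → applyUpTo f q ∈ inits (applyUpTo f n)
  ∈-inits-applyUpTo⁺ f z≤n       = here refl
  ∈-inits-applyUpTo⁺ f (s≤s q≤n) with ∈-inits-applyUpTo⁺ (f ∘ suc) q≤n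
  ... | here eq  = there (here (cong (f 0 ∷_) eq))
  ... | there v∈ = there (there (∈-map⁺ (f 0 ∷_) v∈))

  ∈-tails-applyUpTo⁻ : ∀ (f : ℕ → A) n {v} → v ∈ tails (applyUpTo f n) →
    ∃[ s ] ∃[ r ] s + r ≡ n × v ≡ applyUpTo (λ x → f (s + x)) r
  ∈-tails-applyUpTo⁻ f n       (here refl) = 0 , n , refl , refl
  ∈-tails-applyUpTo⁻ f (suc n) (there (here refl)) = 1 , n , refl , refl
  ∈-tails-applyUpTo⁻ f (suc n) (there (there v∈))
    with ∈-tails-applyUpTo⁻ (f ∘ suc) n (there v∈)
  ... | s , r , refl , refl = suc s , r , refl , refl

  ∈-tails-applyUpTo⁺ : ∀ (f : ℕ → A) s r →
    applyUpTo (λ x → f (s + x)) r ∈ tails (applyUpTo f (s + r))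
  ∈-tails-applyUpTo⁺ f zero    r = here refl
  ∈-tails-applyUpTo⁺ f (suc s) r with ∈-tails-applyUpTo⁺ (f ∘ suc) s r
  ... | here eq  = there (here eq)
  ... | there v∈ = there (there v∈)

  Unique-⊆⇒length≤ : ∀ {xs ys : List A} → Unique xs → (∀ {x} → x ∈ xs → x ∈ ys) →
    length xs ≤ length ys
  Unique-⊆⇒length≤ []          xs⊆ys = z≤n
  Unique-⊆⇒length≤ {x ∷ xs} (x∉xs ∷ xs!) xs⊆ys with ∈-∃++ (xs⊆ys (here refl))
  ... | as , bs , refl = subst (suc (length xs) ≤_) (sym (length-++-sucʳ as x bs))
    (s≤s (Unique-⊆⇒length≤ xs! sub))
    where
    sub : ∀ {y} → y ∈ xs → y ∈ as ++ bs
    sub y∈xs with ∈-++⁻ as (xs⊆ys (there y∈xs))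
    ... | inj₁ y∈as         = ∈-++⁺ˡ y∈as
    ... | inj₂ (here refl)  = contradiction refl (lookup x∉xs y∈xs)
    ... | inj₂ (there y∈bs) = ∈-++⁺ʳ as y∈bs

-- Windows of an infinite word

module Windows {A : Set} (u : ℕ → A) where

  window : ℕ → ℕ → List A
  window i n = applyUpTo (λ x → u (i + x)) n

  Same : ℕ → ℕ → ℕ → Set
  Same n i j = ∀ x → x < n → u (i + x) ≡ u (j + x)

  -- Indexing by pairs with `suc (x + y) ≡ n` avoids truncated subtraction and treats both blocks
  -- alike. On the diagonal, `Mirrored q s s` says that a block is a palindrome.
  Mirrored : ℕ → ℕ → ℕ → Set
  Mirrored n i j = ∀ x y → suc (x + y) ≡ n → u (i + x) ≡ u (j + y)

  Same-restrict : ∀ {n i j} a q → a + q ≤ n → Same n i j → Same q (i + a) (j + a)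
  Same-restrict {i = i} {j} a q a+q≤n same x x<q
    rewrite +-assoc i a x | +-assoc j a x =
    same (a + x) (<-≤-trans (+-monoʳ-< a x<q) a+q≤n)

  -- A reflection exchanges the ends of a block: the `b` letters dropped behind the first block
  -- correspond to those dropped in front of the second.
  Mirrored-restrict : ∀ {n i j} a q b → a + q + b ≡ n → Mirrored n i j →
    Mirrored q (i + a) (j + b)
  Mirrored-restrict {i = i} {j} a q b refl mir x y refl
    rewrite +-assoc i a x | +-assoc j b y = mir (a + x) (b + y) (solve (a ∷ b ∷ x ∷ y ∷ []))

  window-≡⁺ : ∀ {n i j} → Same n i j → window i n ≡ window j n
  window-≡⁺ {n} = applyUpTo-cong n

  window-≡⁻ : ∀ {n i j} → window i n ≡ window j n → Same n i j
  window-≡⁻ {n} = applyUpTo-injective n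

  window-reverse⁺ : ∀ {n i j} → Mirrored n i j → window i n ≡ reverse (window j n)
  window-reverse⁺ {n} {i} {j} mir =
    trans (applyUpTo≡applyDownFrom⁺ n mir) (sym (reverse-applyUpTo (λ x → u (j + x)) n))

  window-reverse⁻ : ∀ {n i j} → window i n ≡ reverse (window j n) → Mirrored n i j
  window-reverse⁻ {n} {i} {j} eq =
    applyUpTo≡applyDownFrom⁻ n (trans eq (reverse-applyUpTo (λ x → u (j + x)) n))

  window-∷ʳ : ∀ i n → window i (suc n) ≡ window i n ∷ʳ u (i + n)
  window-∷ʳ i n = sym (applyUpTo-∷ʳ (λ x → u (i + x)) n)

  window-∷ : ∀ i n → window i (suc n) ≡ u i ∷ window (suc i) n
  window-∷ i n =
    cong₂ _∷_ (cong u (+-identityʳ i)) (applyUpTo-cong n λ x _ → cong u (+-suc i x))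

  -- The palindrome is a suffix u[s , n] of the prefix of length n + 1.
  NewPalindrome : ℕ → Set
  NewPalindrome n =
    ∃[ s ] ∃[ q ] s + q ≡ suc n × Mirrored q s s × (∀ t → t < s → ¬ Same q t s)

  module _ {N : ℕ} (new : ∀ n → N ≤ n → NewPalindrome n) where

    -- The new palindrome ending where the repeated block u[i , i + m) ends cannot lie
    -- inside the block, so it starts to its left and mirrors it.
    repetition⇒mirror : ∀ {i m j} → N < i + m → j < i → Same m j i ⊎ Mirrored m j i →
      ∃[ p ] ∃[ s ] i ≡ suc p × s ≤ p × Mirrored (suc m) s p
    repetition⇒mirror {i} {m} {j} N<i+m j<i copy
      with i + m in i+m≡ | N<i+m
    ... | suc n | s≤s N≤n with new n N≤n
    ... | s , q , s+q≡ , pal , fresh with s <? i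
    ...   | yes s<i with m≤n⇒∃[o]m+o≡n s<i
    -- The palindrome has length `suc m + c`. Its last `suc m` letters are the block with its left
    -- neighbour, at `s + c`; they reflect to its first `suc m` letters, at `s`.
    ...     | c , refl = s + c , s , refl , m≤m+n s c ,
              subst (λ z → Mirrored (suc m) z (s + c)) (+-identityʳ s)
                (Mirrored-restrict 0 (suc m) c (+-cancelˡ-≡ s _ _ len) pal)
      where
      shift : s + (suc m + c) ≡ suc (s + c) + m
      shift = solve (s ∷ m ∷ c ∷ [])
      len : s + (suc m + c) ≡ s + q
      len = trans shift (trans i+m≡ (sym s+q≡))
    repetition⇒mirror {i} {m} {j} N<i+m j<i copy | suc n | s≤s N≤n
      | s , q , s+q≡ , pal , fresh | no s≮i with m≤n⇒∃[o]m+o≡n (≮⇒≥ s≮i)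
    ... | r , refl = ⊥-elim (earlier copy)
      where
      len : r + q ≡ m
      len = +-cancelˡ-≡ i _ _ (trans (sym (+-assoc i r q)) (trans s+q≡ (sym i+m≡)))
      earlier : Same m j i ⊎ Mirrored m j i → ⊥
      earlier (inj₁ same) = fresh (j + r) (+-monoˡ-< r j<i)
        (Same-restrict r q (≤-reflexive len) same)
      -- The palindrome ends the block, so its mirror image begins the copy, at `j`. Reflecting once
      -- more inside the palindrome turns the image into an exact occurrence.
      earlier (inj₂ mir) = fresh j (<-≤-trans j<i (m≤m+n i r)) λ x x<q →
        let y , x+y≡ = m≤n⇒∃[o]m+o≡n x<q in
        trans (subst (λ z → Mirrored q z (i + r)) (+-identityʳ j)
                (Mirrored-restrict 0 q r (trans (+-comm q r) len) mir) x y x+y≡)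
              (sym (pal x y x+y≡))

-- Defects of prefixes

module _ (em : ExcludedMiddle 0ℓ) where

  ¬∀⇒∃¬ : ∀ {A : Set} {P Q : A → Set} → ¬ (∀ {x} → P x → Q x) → ∃[ x ] P x × ¬ Q x
  ¬∀⇒∃¬ {A} {P} {Q} ¬∀ with em {∃[ x ] P x × ¬ Q x}
  ... | yes ∃x = ∃x
  ... | no ¬∃  = contradiction (λ {x} → all x) ¬∀
    where
    all : ∀ x → P x → Q x
    all x px with em {Q x}
    ... | yes qx = qx
    ... | no ¬qx = contradiction (x , px , ¬qx) ¬∃

  -- The slack D + g n − suc n never increases, and it drops whenever g does not grow.
  eventually-increasing : (g : ℕ → ℕ) → (∀ n → g (suc n) ≤ suc (g n)) →
    ∀ D → (∀ n → suc n ≤ D + g n) → ∃[ N ] (∀ n → N ≤ n → g n < g (suc n))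
  eventually-increasing g step D slack = search (D + g 0) 0 (m≤n⇒m≤1+n (≤-reflexive (sym (+-identityʳ _))))
    where
    slack-mono : ∀ s N n → N ≤ n → D + g N ≤ suc (s + N) → D + g n ≤ suc (s + n)
    slack-mono s N n N≤n bound with m≤n⇒∃[o]m+o≡n N≤n
    ... | o , refl = go o
      where
      go : ∀ o → D + g (N + o) ≤ suc (s + (N + o))
      go zero rewrite +-identityʳ N = bound
      go (suc o) rewrite +-suc N o | +-suc s (N + o) = begin
        D + g (suc (N + o))     ≤⟨ +-monoʳ-≤ D (step (N + o)) ⟩
        D + suc (g (N + o))     ≡⟨ +-suc D _ ⟩
        suc (D + g (N + o))     ≤⟨ s≤s (go o) ⟩
        suc (suc (s + (N + o))) ∎
        where open ≤-Reasoning
    -- `s` bounds the slack at `N` and serves as fuel. A failure at `n` restarts the search at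
    -- `suc n` with the bound lowered by one; if the bound is already 0, the slack at `suc n` would
    -- be negative.
    search : ∀ s N → D + g N ≤ suc (s + N) → ∃[ N ] (∀ n → N ≤ n → g n < g (suc n))
    search s N bound with em {∀ {n} → N ≤ n → g n < g (suc n)}
    ... | yes increasing = N , λ n → increasing
    ... | no ¬increasing with ¬∀⇒∃¬ ¬increasing
    ... | n , N≤n , g≮ = next s (slack-mono s N n N≤n bound)
      where
      flat : D + g (suc n) ≤ D + g n
      flat = +-monoʳ-≤ D (≮⇒≥ g≮)
      next : ∀ s → D + g n ≤ suc (s + n) → ∃[ N ] (∀ n → N ≤ n → g n < g (suc n))
      next zero    b = contradiction (≤-trans (slack (suc n)) (≤-trans flat b)) 1+n≰n
      next (suc s) b = search s (suc n) (≤-trans flat (≤-trans b (≤-reflexive (cong suc (sym (+-suc s n))))))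

  module _ {k : ℕ} (u : InfWord k) where
    open Windows u

    prefixPalindromes : ℕ → List (Word k)
    prefixPalindromes n = palindromicFactors (applyUpTo u n)

    ∈-prefixPalindromes⁻ : ∀ n {v} → v ∈ prefixPalindromes n →
      ∃[ s ] ∃[ q ] s + q ≤ n × v ≡ window s q × Mirrored q s s
    ∈-prefixPalindromes⁻ n v∈ with ∈-filter⁻ palindrome? (∈-deduplicate⁻ _≟ʷ_ _ v∈)
    ... | v∈factors , pal with find (∈-concatMap⁻ inits v∈factors)
    ... | t , t∈ , v∈inits with ∈-tails-applyUpTo⁻ u n t∈
    ... | s , r , refl , refl with ∈-inits-applyUpTo⁻ _ r v∈inits
    ... | q , q≤r , refl = s , q , +-monoʳ-≤ s q≤r , refl , window-reverse⁻ pal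

    ∈-prefixPalindromes⁺ : ∀ {n} s q → s + q ≤ n → Mirrored q s s →
      window s q ∈ prefixPalindromes n
    ∈-prefixPalindromes⁺ {n} s q s+q≤n pal with m≤n⇒∃[o]m+o≡n s+q≤n
    ... | o , refl = ∈-deduplicate⁺ _≟ʷ_ (∈-filter⁺ palindrome?
          (∈-concatMap⁺ inits (lose
            (subst (λ z → window s (q + o) ∈ tails (applyUpTo u z)) (sym (+-assoc s q o))
              (∈-tails-applyUpTo⁺ u s (q + o)))
            (∈-inits-applyUpTo⁺ _ (m≤m+n q o))))
          (window-reverse⁺ pal))

    -- A factor that ends before the last letter already lies in the shorter prefix.
    new-suffix : ∀ n {v} → v ∈ prefixPalindromes (suc n) → ¬ v ∈ prefixPalindromes n →
      ∃[ s ] ∃[ q ] s + q ≡ suc n × v ≡ window s q × Mirrored q s s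
    new-suffix n v∈ v∉ with ∈-prefixPalindromes⁻ (suc n) v∈
    ... | s , q , s+q≤ , refl , pal with m≤n⇒m<n∨m≡n s+q≤
    ... | inj₁ (s≤s s+q≤n) = contradiction (∈-prefixPalindromes⁺ s q s+q≤n pal) v∉
    ... | inj₂ s+q≡        = s , q , s+q≡ , refl , pal

    -- A shorter palindromic suffix is also a prefix of a longer one.
    shorter-suffix-old : ∀ {n s q s′ q′} → s + q ≡ suc n → s′ + q′ ≡ suc n →
      Mirrored q s s → Mirrored q′ s′ s′ → s < s′ → window s′ q′ ∈ prefixPalindromes n
    shorter-suffix-old {n} {s} {q} {s′} {q′} s+q≡ s′+q′≡ pal pal′ s<s′
      with m≤n⇒∃[o]m+o≡n s<s′
    ... | o , refl = subst (_∈ prefixPalindromes n) (sym same)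
          (∈-prefixPalindromes⁺ s q′ fits pal″)
      where
      end : s + (suc o + q′) ≡ suc n
      end = trans (sym (+-assoc s (suc o) q′)) (trans (cong (_+ q′) (+-suc s o)) s′+q′≡)
      len : suc o + q′ ≡ q
      len = +-cancelˡ-≡ s _ _ (trans end (sym s+q≡))
      mir : Mirrored q′ (suc (s + o)) s
      mir = subst₂ (Mirrored q′) (+-suc s o) (+-identityʳ s)
              (Mirrored-restrict (suc o) q′ 0 (trans (+-identityʳ _) len) pal)
      same : window (suc (s + o)) q′ ≡ window s q′
      same = trans (window-reverse⁺ pal′)
               (trans (cong reverse (window-reverse⁺ mir)) (reverse-involutive _))
      pal″ : Mirrored q′ s s
      pal″ = window-reverse⁻ (trans (sym same) (window-reverse⁺ mir))
      fits : s + q′ ≤ n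
      fits = s≤s⁻¹ (subst (suc (s + q′) ≤_) s′+q′≡ (s≤s (+-monoˡ-≤ q′ (m≤m+n s o))))

    -- Both words are suffixes of the same prefix. If their starting points differ, the shorter one
    -- is old by `shorter-suffix-old`. Hence each letter adds at most one palindrome.
    new-unique : ∀ n {v v′} → v ∈ prefixPalindromes (suc n) → ¬ v ∈ prefixPalindromes n →
      v′ ∈ prefixPalindromes (suc n) → ¬ v′ ∈ prefixPalindromes n → v ≡ v′
    new-unique n v∈ v∉ v′∈ v′∉ with new-suffix n v∈ v∉ | new-suffix n v′∈ v′∉
    ... | s , q , e , refl , pal | s′ , q′ , e′ , refl , pal′ with <-cmp s s′
    ... | tri< s<s′ _ _ = contradiction (shorter-suffix-old e e′ pal pal′ s<s′) v′∉
    ... | tri> _ _ s′<s = contradiction (shorter-suffix-old e′ e pal′ pal s′<s) v∉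
    ... | tri≈ _ refl _ = cong (window s) (+-cancelˡ-≡ s _ _ (trans e (sym e′)))

    prefixPalindromes-! : ∀ n → Unique (prefixPalindromes n)
    prefixPalindromes-! n = deduplicate-! _≟ʷ_ (filter palindrome? (factors (applyUpTo u n)))

    one-new : ∀ n → length (prefixPalindromes (suc n)) ≤ suc (length (prefixPalindromes n))
    one-new n with em {∀ {v} → v ∈ prefixPalindromes (suc n) → v ∈ prefixPalindromes n}
    ... | yes ⊆ = m≤n⇒m≤1+n (Unique-⊆⇒length≤ (prefixPalindromes-! (suc n)) ⊆)
    ... | no ⊈ with ¬∀⇒∃¬ ⊈
    ... | v , v∈ , v∉ = Unique-⊆⇒length≤ {ys = v ∷ prefixPalindromes n} (prefixPalindromes-! (suc n)) sub
      where
      sub : ∀ {v′} → v′ ∈ prefixPalindromes (suc n) → v′ ∈ v ∷ prefixPalindromes n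
      sub {v′} v′∈ with em {v′ ∈ prefixPalindromes n}
      ... | yes old = there old
      ... | no  v′∉ = here (new-unique n v′∈ v′∉ v∈ v∉)

    grows⇒NewPalindrome : ∀ n →
      length (prefixPalindromes n) < length (prefixPalindromes (suc n)) → NewPalindrome n
    grows⇒NewPalindrome n grows
      with ¬∀⇒∃¬ {P = _∈ prefixPalindromes (suc n)} {_∈ prefixPalindromes n}
             (λ ⊆ → <⇒≱ grows (Unique-⊆⇒length≤ (prefixPalindromes-! (suc n)) ⊆))
    ... | v , v∈ , v∉ with new-suffix n v∈ v∉
    ... | s , q , e , refl , pal = s , q , e , pal , fresh
      where
      fresh : ∀ t → t < s → ¬ Same q t s
      -- An earlier occurrence would end inside the prefix of length `n`, so the palindrome would be
      -- old.
      fresh t t<s same = v∉ (subst (_∈ prefixPalindromes n) w≡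
          (∈-prefixPalindromes⁺ t q (s≤s⁻¹ (subst (t + q <_) e (+-monoˡ-< q t<s)))
            (window-reverse⁻ (trans w≡ (trans (window-reverse⁺ pal) (cong reverse (sym w≡)))))))
        where
        w≡ : window t q ≡ window s q
        w≡ = window-≡⁺ same

    -- The defect of a prefix measures how far its number of palindromes lags behind its length. The
    -- lag is bounded and each letter adds at most one palindrome, so from some point on every
    -- letter adds one.
    finiteDefect⇒NewPalindrome : FiniteDefect u → ∃[ N ] (∀ n → N ≤ n → NewPalindrome n)
    finiteDefect⇒NewPalindrome (d , bounds , _) =
      let N , increasing = eventually-increasing (λ n → length (prefixPalindromes n))
                             one-new ℤ.∣ d ∣ slack
      in N , λ n N≤n → grows⇒NewPalindrome n (increasing n N≤n)
      where
      -- The absolute value turns the integer `d` into the natural bound that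
      -- `eventually-increasing` takes.
      d≤∣d∣ : ∀ i → i ℤ.≤ + ℤ.∣ i ∣
      d≤∣d∣ (+ _)        = ℤₚ.≤-refl
      d≤∣d∣ (ℤ.-[1+ _ ]) = ℤ.-≤+
      slack : ∀ n → suc n ≤ ℤ.∣ d ∣ + length (prefixPalindromes n)
      slack n = ℤₚ.drop‿+≤+ (begin
        + suc n                       ≡⟨ sym (ℤₚ.+-identityʳ _) ⟩
        + suc n ℤ.+ + 0               ≡⟨ cong (λ z → + suc n ℤ.+ z) (sym (ℤₚ.+-inverseˡ (+ g))) ⟩
        + suc n ℤ.+ (ℤ.- + g ℤ.+ + g) ≡⟨ sym (ℤₚ.+-assoc (+ suc n) (ℤ.- + g) (+ g)) ⟩
        + suc n - + g ℤ.+ + g         ≤⟨ ℤₚ.+-monoˡ-≤ (+ g) (ℤₚ.≤-trans bound (d≤∣d∣ d)) ⟩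
        + ℤ.∣ d ∣ ℤ.+ + g ∎)
        where
        open ℤₚ.≤-Reasoning
        g = length (prefixPalindromes n)
        len = length-applyUpTo u n
        bound : + suc n - + g ℤ.≤ d
        bound = subst (λ z → + suc z - + g ℤ.≤ d) len
                  (bounds (applyUpTo u n) (0 , cong (applyUpTo u) (sym len)))

-- Counting with excluded middle

module Counting (em : ExcludedMiddle 0ℓ) where

  module _ {A : Set} where

    card-cong : ∀ (xs : List A) {P Q : Pred A 0ℓ} → P ≐ Q → card em xs P ≡ card em xs Q
    card-cong xs P≐Q = cong length (filter-≐ _ _ P≐Q xs)

    card-none : ∀ (xs : List A) {P : Pred A 0ℓ} → (∀ x → ¬ P x) → card em xs P ≡ 0
    card-none xs ¬P = cong length (filter-none _ (universal ¬P xs))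

    card-cong-∈ : ∀ (xs : List A) {P Q : Pred A 0ℓ} →
      (∀ {x} → x ∈ xs → P x → Q x) → (∀ {x} → x ∈ xs → Q x → P x) →
      card em xs P ≡ card em xs Q
    card-cong-∈ []       P⇒Q Q⇒P = refl
    card-cong-∈ (x ∷ xs) {P} {Q} P⇒Q Q⇒P
      with em {P x} | em {Q x} | card-cong-∈ xs {P} {Q} (P⇒Q ∘ there) (Q⇒P ∘ there)
    ... | yes _  | yes _  | eq = cong suc eq
    ... | no _   | no _   | eq = eq
    ... | yes p  | no ¬q  | _  = contradiction (P⇒Q (here refl) p) ¬q
    ... | no ¬p  | yes q  | _  = contradiction (Q⇒P (here refl) q) ¬p

    card-insert : ∀ {xs : List A} {P Q : Pred A 0ℓ} {a} → Unique xs → a ∈ xs →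
      ¬ P a → Q ≐ (P ∪ ｛ a ｝) → card em xs Q ≡ suc (card em xs P)
    card-insert {x ∷ xs} {P} {Q} (x∉xs ∷ xs!) (here refl) ¬Pa (Q⊆ , ⊆Q)
      with em {P x} | em {Q x}
    ... | yes p | _     = contradiction p ¬Pa
    ... | no _  | no ¬q = contradiction (⊆Q (inj₂ refl)) ¬q
    ... | no _  | yes _ = cong suc (card-cong-∈ xs
          (λ y∈xs q → [ id , (λ x≡y → contradiction x≡y (lookup x∉xs y∈xs)) ]′ (Q⊆ q))
          (λ _ p → ⊆Q (inj₁ p)))
    card-insert {x ∷ xs} {P} {Q} {a} (x∉xs ∷ xs!) (there a∈xs) ¬Pa Q≐@(Q⊆ , ⊆Q)
      with em {P x} | em {Q x} | card-insert {xs} {P} {Q} xs! a∈xs ¬Pa Q≐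
    ... | yes _ | yes _ | eq = cong suc eq
    ... | no _  | no _  | eq = eq
    ... | yes p | no ¬q | _  = contradiction (⊆Q (inj₁ p)) ¬q
    ... | no ¬p | yes q | _  with Q⊆ q
    ...   | inj₁ p    = contradiction p ¬p
    ...   | inj₂ refl = contradiction refl (lookup x∉xs a∈xs)

  card-singleton : ∀ {A : Set} {xs : List A} {a} → Unique xs → a ∈ xs → card em xs ｛ a ｝ ≡ 1
  card-singleton {xs = xs} xs! a∈xs =
    trans (card-insert {P = ∅} xs! a∈xs (λ ()) (inj₂ , [ (λ ()) , id ]′))
          (cong suc (card-none xs {∅} λ _ ()))

  absorb : ∀ {A : Set} {P Q : Pred A 0ℓ} {a} → Q ≐ (P ∪ ｛ a ｝) → P a → Q ≐ P
  absorb (Q⊆ , ⊆Q) Pa = (λ q → [ id , (λ { refl → Pa }) ]′ (Q⊆ q)) , ⊆Q ∘ inj₁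

  -- With `Q j` the vertices or edges met at position `j`, this is the part of the graph traced by
  -- the scan before it reaches `i`.
  Before : ∀ {A : Set} → (ℕ → Pred A 0ℓ) → ℕ → Pred A 0ℓ
  Before Q i x = ∃[ j ] j < i × Q j x

  Before-suc : ∀ {A : Set} (Q : ℕ → Pred A 0ℓ) i → Before Q (suc i) ≐ (Before Q i ∪ Q i)
  Before-suc Q i = to , from
    where
    to : Before Q (suc i) ⊆ (Before Q i ∪ Q i)
    to (j , j<1+i , q) with m≤n⇒m<n∨m≡n j<1+i
    ... | inj₁ (s≤s j<i) = inj₁ (j , j<i , q)
    ... | inj₂ refl      = inj₂ q
    from : (Before Q i ∪ Q i) ⊆ Before Q (suc i)
    from (inj₁ (j , j<i , q)) = j , m<n⇒m<1+n j<i , q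
    from (inj₂ q)             = i , n<1+n i , q

  Before-stable : ∀ {A : Set} {Q : ℕ → Pred A 0ℓ} {i} → (∀ x → ¬ Q i x) →
    Before Q (suc i) ≐ Before Q i
  Before-stable {Q = Q} {i} ¬Q = let to , from = Before-suc Q i in
    (λ b → [ id , (λ q → contradiction q (¬Q _)) ]′ (to b)) , from ∘ inj₁

  Before-add : ∀ {A : Set} {Q : ℕ → Pred A 0ℓ} {i} {R : Pred A 0ℓ} → Q i ≐ R →
    Before Q (suc i) ≐ (Before Q i ∪ R)
  Before-add {Q = Q} {i} (Q⊆ , ⊆Q) = let to , from = Before-suc Q i in
    (λ b → Sum.map₂ Q⊆ (to b)) , from ∘ Sum.map₂ ⊆Q

  Before-first : ∀ {A : Set} {Q : ℕ → Pred A 0ℓ} {i} {R : Pred A 0ℓ} →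
    (∀ {x} → ¬ Before Q i x) → Q i ≐ R →
    Before Q (suc i) ≐ R
  Before-first {Q = Q} {i} ¬before Q≐ = let to , from = Before-add {Q = Q} {i} Q≐ in
    (λ b → [ (λ q → contradiction q ¬before) , id ]′ (to b)) , from ∘ inj₂

  -- At the first occurrence nothing has been seen yet; this lets the general step lemmas run from
  -- the literal set `∅`.
  from-empty : ∀ {A : Set} {P Q R : Pred A 0ℓ} → (∀ {x} → ¬ P x) → Q ≐ (P ∪ R) → Q ≐ (∅ ∪ R)
  from-empty ¬P (Q⊆ , ⊆Q) = (λ q → Sum.map₁ ¬P (Q⊆ q)) , [ (λ ()) , ⊆Q ∘ inj₂ ]′

  Before-mono : ∀ {A : Set} {Q : ℕ → Pred A 0ℓ} {i i′} → i ≤ i′ → Before Q i ⊆ Before Q i′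
  Before-mono i≤i′ (j , j<i , q) = j , <-≤-trans j<i i≤i′ , q

  -- Excluded middle decides which entries of the finite list ever appear. The stages of their
  -- appearances are added up, a sum being at least each of its terms.
  Before-exhausts : ∀ {A : Set} (xs : List A) (Q : ℕ → Pred A 0ℓ) →
    ∃[ n ] (∀ {x} → x ∈ xs → ∃[ j ] Q j x → Before Q n x)
  Before-exhausts []       Q = 0 , λ ()
  Before-exhausts (x ∷ xs) Q with Before-exhausts xs Q | em {∃[ j ] Q j x}
  ... | n , all | no ¬q       = n , λ { (here refl) q → contradiction q ¬q ; (there x∈) → all x∈ }
  ... | n , all | yes (j , q) = suc j + n , λ
    { (here refl) _ → j , m≤m+n (suc j) n , q
    ; (there x∈) q′ → Before-mono {Q = Q} (m≤n+m n (suc j)) (all x∈ q′) }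

  module _ {X Y : Set} {xs : List X} {ys : List Y} (xs! : Unique xs) (ys! : Unique ys)
           (∈xs : ∀ x → x ∈ xs) (∈ys : ∀ y → y ∈ ys) where

    -- The equation is that of a tree with vertex classes `A` and `B`: one more vertex than edges.
    -- The class `A` does not grow, and `b` is known exactly when `e` is, so edges and vertices both
    -- grow by one or not at all.
    bipartite-step : ∀ {A A′ B B′ : Pred X 0ℓ} {E E′ : Pred Y 0ℓ} {b e} →
      A′ ≐ A → B′ ≐ (B ∪ ｛ b ｝) → E′ ≐ (E ∪ ｛ e ｝) → (B b → E e) → (E e → B b) →
      card em ys E + 1 ≡ card em xs A + card em xs B →
      card em ys E′ + 1 ≡ card em xs A′ + card em xs B′
    bipartite-step {A} {B = B} {E = E} {b = b} {e} A≐ B≐ E≐ b⇒e e⇒b eq with em {E e}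
    ... | yes old rewrite card-cong xs A≐ | card-cong xs (absorb B≐ (e⇒b old))
                        | card-cong ys (absorb E≐ old) = eq
    ... | no new rewrite card-cong xs A≐ | card-insert {P = B} xs! (∈xs b) (new ∘ b⇒e) B≐
                       | card-insert {P = E} ys! (∈ys e) new E≐ =
      trans (cong suc eq) (sym (+-suc _ _))

  loop : ∀ {X : Set} → Pred (X × X) 0ℓ → Pred X 0ℓ
  loop E a = E (a , a)

  module _ {X : Set} {xs : List X} {ys : List (X × X)} (xs! : Unique xs) (ys! : Unique ys)
           (∈xs : ∀ x → x ∈ xs) (∈ys : ∀ y → y ∈ ys) where

    -- A tree on v vertices has v - 1 proper edges, each giving two ordered pairs, and every loop
    -- gives one pair more; hence the constant 2. A known edge changes nothing, a new loop adds one
    -- pair and one loop, and a new proper edge adds two pairs and one vertex.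
    symmetric-step : ∀ {V V′ : Pred X 0ℓ} {E E′ : Pred (X × X) 0ℓ} {a b} →
      V′ ≐ (V ∪ ｛ b ｝) → E′ ≐ (E ∪ (｛ (a , b) ｝ ∪ ｛ (b , a) ｝)) →
      V a → (V b → a ≡ b ⊎ E (a , b)) → (E (a , b) → V b) → (E (a , b) → E (b , a)) →
      (E (b , a) → E (a , b)) →
      card em ys E + 2 ≡ card em xs V + card em xs V + card em xs (loop E) →
      card em ys E′ + 2 ≡ card em xs V′ + card em xs V′ + card em xs (loop E′)
    symmetric-step {V} {V′} {E} {E′} {a} {b} V≐ (E⊆ , ⊆E) Va b⇒e e⇒b ab⇒ba ba⇒ab eq
      with em {E (a , b)}
    ... | yes old = unchanged
      where
      E′≐ : E′ ≐ E
      E′≐ = (λ e → [ id , [ (λ { refl → old }) , (λ { refl → ab⇒ba old }) ]′ ]′ (E⊆ e)) , ⊆E ∘ inj₁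
      loop≐ : loop E′ ≐ loop E
      loop≐ = proj₁ E′≐ , proj₂ E′≐
      unchanged : card em ys E′ + 2 ≡ card em xs V′ + card em xs V′ + card em xs (loop E′)
      unchanged rewrite card-cong xs (absorb V≐ (e⇒b old)) | card-cong ys E′≐
                      | card-cong xs loop≐ = eq
    ... | no new with em {a ≡ b}
    ...   | yes refl = new-loop
      where
      E′≐ : E′ ≐ (E ∪ ｛ (a , a) ｝)
      E′≐ = (λ e → [ inj₁ , [ inj₂ , inj₂ ]′ ]′ (E⊆ e)) , [ ⊆E ∘ inj₁ , ⊆E ∘ inj₂ ∘ inj₁ ]′
      loop≐ : loop E′ ≐ (loop E ∪ ｛ a ｝)
      loop≐ = (λ e → [ inj₁ , (λ { refl → inj₂ refl }) ]′ (proj₁ E′≐ e)) ,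
              [ proj₂ E′≐ ∘ inj₁ , (λ { refl → proj₂ E′≐ (inj₂ refl) }) ]′
      new-loop : card em ys E′ + 2 ≡ card em xs V′ + card em xs V′ + card em xs (loop E′)
      new-loop rewrite card-cong xs (absorb V≐ Va)
                     | card-insert {P = E} ys! (∈ys (a , a)) new E′≐
                     | card-insert {P = loop E} xs! (∈xs a) new loop≐ =
        trans (cong suc eq) (sym (+-suc _ _))
    ...   | no a≢b = new-edge
      where
      ba-new : ¬ (E ∪ ｛ (a , b) ｝) (b , a)
      ba-new (inj₁ e)    = new (ba⇒ab e)
      ba-new (inj₂ refl) = a≢b refl
      E′≐ : E′ ≐ ((E ∪ ｛ (a , b) ｝) ∪ ｛ (b , a) ｝)
      E′≐ = (λ e → [ inj₁ ∘ inj₁ , [ inj₁ ∘ inj₂ , inj₂ ]′ ]′ (E⊆ e)) ,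
            [ [ ⊆E ∘ inj₁ , ⊆E ∘ inj₂ ∘ inj₁ ]′ , ⊆E ∘ inj₂ ∘ inj₂ ]′
      loop≐ : loop E′ ≐ loop E
      loop≐ = (λ e → [ id , [ (λ { refl → contradiction refl a≢b })
                            , (λ { refl → contradiction refl a≢b }) ]′ ]′ (E⊆ e)) , ⊆E ∘ inj₁
      arith : ∀ v l → suc (suc (v + v + l)) ≡ suc v + suc v + l
      arith v l = solve (v ∷ l ∷ [])
      new-edge : card em ys E′ + 2 ≡ card em xs V′ + card em xs V′ + card em xs (loop E′)
      new-edge rewrite card-insert {P = V} xs! (∈xs b) ([ a≢b , new ]′ ∘ b⇒e) V≐
                     | card-insert {P = E ∪ ｛ (a , b) ｝} {Q = E′} ys! (∈ys (b , a)) ba-new E′≐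
                     | card-insert {P = E} ys! (∈ys (a , b)) new (id , id)
                     | card-cong xs loop≐ =
        trans (cong (λ z → suc (suc z)) eq) (arith (card em xs V) (card em xs (loop E)))

-- The graph of extensions

module Extensions (em : ExcludedMiddle 0ℓ) {k : ℕ} (u : InfWord k)
  {N : ℕ} (new : ∀ n → N ≤ n → Windows.NewPalindrome u n) (l : ℕ) (N≤l : N ≤ l) where

  open Windows u
  open Counting em

  At : Word k → ℕ → Set
  At z j = z ≡ window j l

  Next Prev : ℕ → Pred (Fin k) 0ℓ
  Next j b = u (j + l) ≡ b
  Prev j a = ∃[ p ] j ≡ suc p × u p ≡ a

  -- Let z′ be the reversal of z. A vertex b stands for the words zb and b z′, an edge
  -- (a , b) for the words azb and b z′ a; j is the position of z or z′ itself.
  Vertex : Word k → Word k → ℕ → Pred (Fin k) 0ℓ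
  Vertex z z′ j b = (At z j × Next j b) ⊎ (At z′ j × Prev j b)

  Edge : Word k → Word k → ℕ → Pred (Fin k × Fin k) 0ℓ
  Edge z z′ j (a , b) = (At z j × Prev j a × Next j b) ⊎ (At z′ j × Prev j b × Next j a)

  Occurs : Word k → Word k → ℕ → Set
  Occurs z z′ i = ∃[ j ] j < i × (At z j ⊎ At z′ j)

  Edge⇒Vertex : ∀ {z z′ i a b} → Before (Edge z z′) i (a , b) → Before (Vertex z z′) i b
  Edge⇒Vertex (j , j<i , inj₁ (at , _ , next)) = j , j<i , inj₁ (at , next)
  Edge⇒Vertex (j , j<i , inj₂ (at , prev , _)) = j , j<i , inj₂ (at , prev)

  module _ {z z′ : Word k} (z′≡ : z′ ≡ reverse z) where

    At⇒At-copy : ∀ {i j} → At z i → At z j → Same l j i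
    At⇒At-copy at at′ = window-≡⁻ (trans (sym at′) at)

    At⇒At-mirror : ∀ {i j} → At z i → At z′ j → Mirrored l j i
    At⇒At-mirror at at′ = window-reverse⁻ (trans (sym at′) (trans z′≡ (cong reverse at)))

    mirror⇒At : ∀ {i j} → At z i → Mirrored l j i → At z′ j
    mirror⇒At at mir = trans z′≡ (trans (cong reverse at) (sym (window-reverse⁺ mir)))

    -- The occurrence at `i` repeats an earlier one up to reversal, so `repetition⇒mirror` yields an
    -- earlier `z′` followed by the left neighbour of `i`. The earlier occurrence also makes `i`
    -- positive, whence `N < i + l`.
    left-vertex-old : ∀ {i} → At z i → Occurs z z′ i →
      ∃[ p ] i ≡ suc p × Before (Vertex z′ z) i (u p)
    left-vertex-old {i} at (j , j<i , occ)
      with repetition⇒mirror new {i} {l} {j} (≤-<-trans N≤l (m<n+m l (≤-<-trans z≤n j<i))) j<i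
             (Sum.map (At⇒At-copy at) (At⇒At-mirror at) occ)
    ... | p , s , refl , s≤p , mir = p , refl , s , s≤s s≤p , inj₁ (mirror⇒At at inner , next)
      where
      next : u (s + l) ≡ u p
      next = trans (mir l 0 (cong suc (+-identityʳ l))) (cong u (+-identityʳ p))
      inner : Mirrored l s (suc p)
      inner = subst₂ (Mirrored l) (+-identityʳ s) (+-comm p 1)
                (Mirrored-restrict 0 l 1 (+-comm l 1) mir)

    -- An old right vertex means that `z` with its right neighbour repeats an earlier block up to
    -- reversal. `repetition⇒mirror` then reflects the whole word `azb` to a start `s ≤ p`. If
    -- `s < p`, the edge is old; if `s = p`, the word `azb` is a palindrome and the edge is a loop.
    right-vertex-old⇒edge-old : ∀ {p} → At z (suc p) →
      Before (Vertex z z′) (suc p) (u (suc p + l)) →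
      (u p ≡ u (suc p + l) × z ≡ z′) ⊎ Before (Edge z z′) (suc p) (u p , u (suc p + l))
    right-vertex-old⇒edge-old {p} at old = conclude (copy old)
      where
      copy : Before (Vertex z z′) (suc p) (u (suc p + l)) →
        ∃[ j ] j < suc p × (Same (suc l) j (suc p) ⊎ Mirrored (suc l) j (suc p))
      copy (j , j<i , inj₁ (at′ , next)) = j , j<i , inj₁ (window-≡⁻ (begin
        window j (suc l)                     ≡⟨ window-∷ʳ j l ⟩
        window j l ∷ʳ u (j + l)              ≡⟨ cong₂ _∷ʳ_ (trans (sym at′) at) next ⟩
        window (suc p) l ∷ʳ u (suc p + l)    ≡⟨ window-∷ʳ (suc p) l ⟨
        window (suc p) (suc l)               ∎))
        where open ≡-Reasoning
      -- The reversed block consists of `z′` and the letter before it, so it starts at `q`, one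
      -- position to the left of `z′`.
      copy (.(suc q) , s≤s q<p , inj₂ (at′ , q , refl , prev)) =
        q , m<n⇒m<1+n q<p , inj₂ (window-reverse⁻ (begin
        window q (suc l)                            ≡⟨ window-∷ q l ⟩
        u q ∷ window (suc q) l                      ≡⟨ cong₂ _∷_ prev (window-reverse⁺ (At⇒At-mirror at at′)) ⟩
        u (suc p + l) ∷ reverse (window (suc p) l)  ≡⟨ reverse-++ (window (suc p) l) [ u (suc p + l) ] ⟨
        reverse (window (suc p) l ∷ʳ u (suc p + l)) ≡⟨ cong reverse (window-∷ʳ (suc p) l) ⟨
        reverse (window (suc p) (suc l))            ∎))
        where open ≡-Reasoning
      bound : N < suc p + suc l
      bound = s≤s (≤-trans N≤l (≤-trans (n≤1+n l) (m≤n+m (suc l) p)))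
      conclude : (∃[ j ] j < suc p × (Same (suc l) j (suc p) ⊎ Mirrored (suc l) j (suc p))) →
        (u p ≡ u (suc p + l) × z ≡ z′) ⊎ Before (Edge z z′) (suc p) (u p , u (suc p + l))
      conclude (j , j<i , c) with repetition⇒mirror new bound j<i c
      ... | .p , s , refl , s≤p , mir = result (m≤n⇒m<n∨m≡n s≤p)
        where
        inner : Mirrored l (suc s) (suc p)
        inner = subst₂ (Mirrored l) (+-comm s 1) (+-comm p 1)
                  (Mirrored-restrict 1 l 1 (cong suc (+-comm l 1)) mir)
        first : u s ≡ u (suc p + l)
        first = trans (cong u (sym (+-identityʳ s)))
                  (trans (mir 0 (suc l) refl) (cong u (+-suc p l)))
        last : u (suc s + l) ≡ u p
        last = trans (cong u (sym (+-suc s l)))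
                 (trans (mir (suc l) 0 (cong (suc ∘ suc) (+-identityʳ l))) (cong u (+-identityʳ p)))
        result : s < p ⊎ s ≡ p →
          (u p ≡ u (suc p + l) × z ≡ z′) ⊎ Before (Edge z z′) (suc p) (u p , u (suc p + l))
        result (inj₁ s<p)  = inj₂ (suc s , s≤s s<p , inj₂ (mirror⇒At at inner , (s , refl , first) , last))
        result (inj₂ refl) = inj₁ (first , trans at (sym (mirror⇒At at inner)))

  letters : List (Fin k)
  letters = allFin k

  pairs : List (Fin k × Fin k)
  pairs = cartesianProduct letters letters

  letters-! : Unique letters
  letters-! = Uniqueₚ.allFin⁺ k

  pairs-! : Unique pairs
  pairs-! = Uniqueₚ.cartesianProduct⁺ letters-! letters-!

  ∈-pairs : ∀ e → e ∈ pairs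
  ∈-pairs (a , b) = ∈-cartesianProduct⁺ (∈-allFin a) (∈-allFin b)

  #Before : (ℕ → Pred (Fin k) 0ℓ) → ℕ → ℕ
  #Before Q i = card em letters (Before Q i)

  Occurs-suc : ∀ {z z′ i} → Occurs z z′ (suc i) → ¬ At z i → ¬ At z′ i → Occurs z z′ i
  Occurs-suc (j , j<1+i , occ) ¬z ¬z′ with m≤n⇒m<n∨m≡n j<1+i
  ... | inj₁ (s≤s j<i) = j , j<i , occ
  ... | inj₂ refl      = contradiction occ [ ¬z , ¬z′ ]′

  Occurs-sym : ∀ {z z′ i} → Occurs z z′ i → Occurs z′ z i
  Occurs-sym (j , j<i , occ) = j , j<i , Sum.swap occ

  Vertex⇒Occurs : ∀ {z z′ i b} → Before (Vertex z z′) i b → Occurs z z′ i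
  Vertex⇒Occurs (j , j<i , v) = j , j<i , Sum.map proj₁ proj₁ v

  Edge⇒Occurs : ∀ {z z′ i e} → Before (Edge z z′) i e → Occurs z z′ i
  Edge⇒Occurs (j , j<i , v) = j , j<i , Sum.map proj₁ proj₁ v

  -- The bipartite tree of a word that is not a palindrome

  module NonPalindrome {z z′ : Word k} (z′≡ : z′ ≡ reverse z) (z≢z′ : z ≢ z′) where

    -- f is the identity or swap: exchanging z and z′ transposes the edges.
    module _ (f : Fin k × Fin k → Fin k × Fin k) (f-involutive : ∀ e → f (f e) ≡ e) where

      Edgeᶠ : ℕ → Pred (Fin k × Fin k) 0ℓ
      Edgeᶠ j e = Edge z z′ j (f e)

      Balanced : ℕ → Set
      Balanced i = card em pairs (Before Edgeᶠ i) + 1 ≡ #Before (Vertex z′ z) i + #Before (Vertex z z′) i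

      -- The induction hypothesis is conditional because the empty graph, before the first
      -- occurrence, violates the equation: it would read 1 = 0.
      balanced-step : ∀ i → At z i → (Occurs z z′ i → Balanced i) → Balanced (suc i)
      balanced-step i at ih = step i at ih em
        where
        ¬At′ : ∀ {i} → At z i → ¬ At z′ i
        ¬At′ at at′ = z≢z′ (trans at (sym at′))
        right : ∀ {i} → At z i → Vertex z z′ i ≐ ｛ u (i + l) ｝
        right at = (λ { (inj₁ (_ , next)) → next ; (inj₂ (at′ , _)) → contradiction at′ (¬At′ at) }) ,
                   λ next → inj₁ (at , next)
        left : ∀ {p} → At z (suc p) → Vertex z′ z (suc p) ≐ ｛ u p ｝
        left at = (λ { (inj₁ (at′ , _)) → contradiction at′ (¬At′ at) ; (inj₂ (_ , _ , refl , prev)) → prev }) ,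
                  λ prev → inj₂ (at , _ , refl , prev)
        edge : ∀ {p} → At z (suc p) → Edgeᶠ (suc p) ≐ ｛ f (u p , u (suc p + l)) ｝
        edge at = (λ { (inj₁ (_ , (_ , refl , prev) , next)) → trans (cong f (cong₂ _,_ prev next)) (f-involutive _)
                     ; (inj₂ (at′ , _)) → contradiction at′ (¬At′ at) }) ,
                  λ { refl → subst (Edge z z′ _) (sym (f-involutive _)) (inj₁ (at , (_ , refl , refl) , refl)) }
        step : ∀ i → At z i → (Occurs z z′ i → Balanced i) →
          Dec (Occurs z z′ i) → Balanced (suc i)
        step i at ih (yes occ) with left-vertex-old z′≡ at occ
        ... | p , refl , old =
          bipartite-step letters-! pairs-! ∈-allFin ∈-pairs
            (absorb (Before-add (left at)) old) (Before-add (right at)) (Before-add (edge at))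
            (λ v → [ (λ (_ , z≡) → contradiction z≡ z≢z′)
                   , (λ (j , j<i , e) → j , j<i , subst (Edge z z′ j) (sym (f-involutive _)) e) ]′
                   (right-vertex-old⇒edge-old z′≡ at v))
            (λ (j , j<i , e) → Edge⇒Vertex (j , j<i , subst (Edge z z′ j) (f-involutive _) e))
            (ih occ)
        -- Position 0 has no left neighbour, so the tree starts as the right vertex alone, without
        -- an edge.
        step zero at ih (no ¬occ) = start
          where
          no-left : ∀ {a} → ¬ Vertex z′ z 0 a
          no-left (inj₁ (at′ , _)) = ¬At′ at at′
          no-left (inj₂ (_ , _ , () , _))
          no-edge : ∀ {e} → ¬ Edgeᶠ 0 e
          no-edge (inj₁ (_ , (_ , () , _) , _))
          no-edge (inj₂ (at′ , _)) = ¬At′ at at′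
          start : Balanced 1
          start
            rewrite card-none pairs {Before Edgeᶠ 1} (λ { _ (_ , s≤s z≤n , e) → no-edge e })
                  | card-none letters {Before (Vertex z′ z) 1} (λ { _ (_ , s≤s z≤n , v) → no-left v })
                  | card-cong letters (Before-first (¬occ ∘ Vertex⇒Occurs) (right at))
                  | card-singleton letters-! (∈-allFin (u l)) = refl
        -- A first occurrence with a left neighbour is an ordinary step from the tree whose only
        -- vertex is `u p`.
        step (suc p) at ih (no ¬occ) =
          bipartite-step letters-! pairs-! ∈-allFin ∈-pairs {A = ｛ u p ｝} {B = ∅} {E = ∅}
            (Before-first (¬occ ∘ Occurs-sym ∘ Vertex⇒Occurs) (left at))
            (from-empty (¬occ ∘ Vertex⇒Occurs) (Before-add (right at)))
            (from-empty (¬occ ∘ Edge⇒Occurs) (Before-add (edge at)))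
            (λ ()) (λ ()) start
          where
          start : card em pairs ∅ + 1 ≡ card em letters ｛ u p ｝ + card em letters ∅
          start rewrite card-none pairs {∅} (λ _ ()) | card-none letters {∅} (λ _ ())
                      | card-singleton letters-! (∈-allFin (u p)) = refl

  module _ {w w′ : Word k} (w′≡ : w′ ≡ reverse w) (w≢w′ : w ≢ w′) where
    open NonPalindrome

    bipartite-balance : ∀ i → Occurs w w′ i →
      card em pairs (Before (Edge w w′) i) + 1 ≡
      #Before (Vertex w′ w) i + #Before (Vertex w w′) i
    bipartite-balance (suc i) occ with em {At w i} | em {At w′ i}
    ... | yes at | _ = balanced-step w′≡ w≢w′ id (λ _ → refl) i at (bipartite-balance i)
    -- An occurrence of `w′` is a step for the exchanged pair: edges are transposed and the two
    -- vertex classes change places.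
    ... | no _ | yes at′ = begin
      card em pairs (Before (Edge w w′) (suc i)) + 1 ≡⟨ cong (_+ 1) (swapped (suc i)) ⟩
      card em pairs (Before (λ j e → Edge w′ w j (swap e)) (suc i)) + 1
        ≡⟨ balanced-step w≡ (w≢w′ ∘ sym) swap (λ _ → refl) i at′
             (λ occ′ → trans (cong (_+ 1) (sym (swapped i)))
                         (trans (bipartite-balance i (Occurs-sym occ′)) (+-comm (#Before (Vertex w′ w) i) _))) ⟩
      #Before (Vertex w w′) (suc i) + #Before (Vertex w′ w) (suc i) ≡⟨ +-comm (#Before (Vertex w w′) (suc i)) _ ⟩
      #Before (Vertex w′ w) (suc i) + #Before (Vertex w w′) (suc i) ∎
      where
      open ≡-Reasoning
      w≡ : w ≡ reverse w′
      w≡ = trans (sym (reverse-involutive w)) (cong reverse (sym w′≡))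
      swapped : ∀ i → card em pairs (Before (Edge w w′) i) ≡
                      card em pairs (Before (λ j e → Edge w′ w j (swap e)) i)
      swapped i = card-cong pairs ((λ (j , j<i , e) → j , j<i , Sum.swap e) ,
                                   (λ (j , j<i , e) → j , j<i , Sum.swap e))
    ... | no ¬at | no ¬at′
      rewrite card-cong pairs (Before-stable {Q = Edge w w′} {i} (λ _ → [ ¬at ∘ proj₁ , ¬at′ ∘ proj₁ ]′))
            | card-cong letters (Before-stable {Q = Vertex w′ w} {i} (λ _ → [ ¬at′ ∘ proj₁ , ¬at ∘ proj₁ ]′))
            | card-cong letters (Before-stable {Q = Vertex w w′} {i} (λ _ → [ ¬at ∘ proj₁ , ¬at′ ∘ proj₁ ]′)) =
      bipartite-balance i (Occurs-suc occ ¬at ¬at′)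

  -- The tree with loops of a palindrome

  module _ {w : Word k} (w≡ : w ≡ reverse w) where

    V : ℕ → Pred (Fin k) 0ℓ
    V = Vertex w w

    Edgeʷ : ℕ → Pred (Fin k × Fin k) 0ℓ
    Edgeʷ = Edge w w

    Balanced : ℕ → Set
    Balanced i = card em pairs (Before Edgeʷ i) + 2 ≡
                 #Before V i + #Before V i + card em letters (loop (Before Edgeʷ i))

    -- As `w` is its own reversal, both alternatives of `Vertex` apply at once, and an occurrence
    -- contributes both of its neighbours to a single class.
    V-event : ∀ {p} → At w (suc p) → V (suc p) ≐ (｛ u p ｝ ∪ ｛ u (suc p + l) ｝)
    V-event at =
      (λ { (inj₁ (_ , next)) → inj₂ next ; (inj₂ (_ , _ , refl , prev)) → inj₁ prev }) ,
      λ { (inj₁ prev) → inj₂ (at , _ , refl , prev) ; (inj₂ next) → inj₁ (at , next) }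

    Edgeʷ-event : ∀ {p} → At w (suc p) →
      Edgeʷ (suc p) ≐ (｛ (u p , u (suc p + l)) ｝ ∪ ｛ (u (suc p + l) , u p) ｝)
    Edgeʷ-event at =
      (λ { (inj₁ (_ , (_ , refl , prev) , next)) → inj₁ (cong₂ _,_ prev next)
         ; (inj₂ (_ , (_ , refl , prev) , next)) → inj₂ (cong₂ _,_ next prev) }) ,
      λ { (inj₁ refl) → inj₁ (at , (_ , refl , refl) , refl)
        ; (inj₂ refl) → inj₂ (at , (_ , refl , refl) , refl) }

    Edge-sym : ∀ {i a b} → Before Edgeʷ i (a , b) → Before Edgeʷ i (b , a)
    Edge-sym (j , j<i , e) = j , j<i , Sum.swap e

    symmetric-balanced-step : ∀ i → At w i → Dec (Occurs w w i) →
      (Occurs w w i → Balanced i) → Balanced (suc i)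
    symmetric-balanced-step i at (yes occ) ih with left-vertex-old w≡ at occ
    ... | p , refl , old =
      symmetric-step letters-! pairs-! ∈-allFin ∈-pairs
        (V⊆ , ⊆V) (Before-add (Edgeʷ-event at)) old
        (λ v → Sum.map₁ proj₁ (right-vertex-old⇒edge-old w≡ at v))
        Edge⇒Vertex Edge-sym Edge-sym (ih occ)
      where
      V′≐ : Before V (suc (suc p)) ≐ (Before V (suc p) ∪ (｛ u p ｝ ∪ ｛ u (suc p + l) ｝))
      V′≐ = Before-add (V-event at)
      -- The left neighbour is already a vertex by `old`, so only the right one can be new.
      V⊆ : Before V (suc (suc p)) ⊆ (Before V (suc p) ∪ ｛ u (suc p + l) ｝)
      V⊆ v = [ inj₁ , [ (λ { refl → inj₁ old }) , inj₂ ]′ ]′ (proj₁ V′≐ v)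
      ⊆V : (Before V (suc p) ∪ ｛ u (suc p + l) ｝) ⊆ Before V (suc (suc p))
      ⊆V = proj₂ V′≐ ∘ Sum.map₂ inj₂
    symmetric-balanced-step zero at (no ¬occ) ih = start
      where
      no-edge : ∀ {e} → ¬ Edgeʷ 0 e
      no-edge (inj₁ (_ , (_ , () , _) , _))
      no-edge (inj₂ (_ , (_ , () , _) , _))
      event : V 0 ≐ ｛ u l ｝
      event = (λ { (inj₁ (_ , next)) → next ; (inj₂ (_ , _ , () , _)) }) , λ next → inj₁ (at , next)
      start : Balanced 1
      start
        rewrite card-none pairs {Before Edgeʷ 1} (λ { _ (_ , s≤s z≤n , e) → no-edge e })
              | card-none letters {loop (Before Edgeʷ 1)} (λ { _ (_ , s≤s z≤n , e) → no-edge e })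
              | card-cong letters (Before-first (¬occ ∘ Vertex⇒Occurs) event)
              | card-singleton letters-! (∈-allFin (u l)) = refl
    -- As in the bipartite case, the step starts from the single vertex `u p`; the right neighbour
    -- is then known only if the edge is a loop.
    symmetric-balanced-step (suc p) at (no ¬occ) ih =
      symmetric-step letters-! pairs-! ∈-allFin ∈-pairs {V = ｛ u p ｝} {E = ∅}
        (Before-first (¬occ ∘ Vertex⇒Occurs) (V-event at))
        (from-empty (¬occ ∘ Edge⇒Occurs) (Before-add (Edgeʷ-event at)))
        refl inj₁ (λ ()) (λ ()) (λ ()) start
      where
      start : card em pairs ∅ + 2 ≡
              card em letters ｛ u p ｝ + card em letters ｛ u p ｝ + card em letters ∅
      start rewrite card-none pairs {∅} (λ _ ()) | card-none letters {∅} (λ _ ())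
                  | card-singleton letters-! (∈-allFin (u p)) = refl

    symmetric-balance : ∀ i → Occurs w w i → Balanced i
    symmetric-balance (suc i) occ with em {At w i}
    ... | yes at = symmetric-balanced-step i at em (symmetric-balance i)
    ... | no ¬at = unchanged
      where
      no-event : ∀ {e} → ¬ Edgeʷ i e
      no-event = [ ¬at ∘ proj₁ , ¬at ∘ proj₁ ]′
      unchanged : Balanced (suc i)
      unchanged
        rewrite card-cong pairs (Before-stable {Q = Edgeʷ} {i} (λ _ → no-event))
              | card-cong letters (Before-stable {Q = V} {i} (λ _ → [ ¬at ∘ proj₁ , ¬at ∘ proj₁ ]′))
              | card-cong letters {loop (Before Edgeʷ (suc i))} {loop (Before Edgeʷ i)}
                  (Before-stable {Q = λ j → loop (Edgeʷ j)} {i} (λ _ → no-event)) =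
        symmetric-balance i (Occurs-suc occ ¬at ¬at)

-- Extension sets of a long factor and its bilateral multiplicity

module _ (em : ExcludedMiddle 0ℓ) {k : ℕ} {u : InfWord k} (closed : ClosedUnderReversal u)
  {N : ℕ} (new : ∀ n → N ≤ n → Windows.NewPalindrome u n) {w : Word k} (N≤∣w∣ : N ≤ length w) where

  open Windows u
  open Counting em
  open Extensions em u new (length w) N≤∣w∣

  private
    l = length w
    w′ = reverse w

  window⇒Factor : ∀ {v} i n → v ≡ window i n → Factor u v
  window⇒Factor i n refl = i , cong (window i) (sym (length-applyUpTo _ n))

  Factor⇒window : ∀ {v n} → length v ≡ n → Factor u v → ∃[ i ] v ≡ window i n
  Factor⇒window refl f = f

  length-∷ʳ : ∀ (v : Word k) b → length (v ∷ʳ b) ≡ suc (length v)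
  length-∷ʳ v b = trans (length-++ v) (+-comm (length v) 1)

  reverse-∷ʳ : ∀ (v : Word k) b → reverse (v ∷ʳ b) ≡ b ∷ reverse v
  reverse-∷ʳ v b = reverse-++ v [ b ]

  window-∷ʳ⁻ : ∀ {z b j} → z ∷ʳ b ≡ window j (suc l) → At z j × Next j b
  window-∷ʳ⁻ {z} {b} {j} eq =
    let z≡ , b≡ = ∷ʳ-injective z (window j l) (trans eq (window-∷ʳ j l)) in z≡ , sym b≡

  window-∷⁻ : ∀ {z a p n} → a ∷ z ≡ window p (suc n) → u p ≡ a × z ≡ window (suc p) n
  window-∷⁻ {z} {a} {p} {n} eq =
    let a≡ , z≡ = ∷-injective (trans eq (window-∷ p n)) in sym a≡ , z≡

  Next⇒Factor : ∀ {z b j} → At z j → Next j b → Factor u (z ∷ʳ b)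
  Next⇒Factor {j = j} at next =
    window⇒Factor j (suc l) (trans (cong₂ _∷ʳ_ at (sym next)) (sym (window-∷ʳ j l)))

  Prev⇒Factor : ∀ {z a j} → At z j → Prev j a → Factor u (a ∷ z)
  Prev⇒Factor at (p , refl , prev) =
    window⇒Factor p (suc l) (trans (cong₂ _∷_ (sym prev) at) (sym (window-∷ p l)))

  Prev-Next⇒Factor : ∀ {z a b j} → At z j → Prev j a → Next j b → Factor u (a ∷ (z ∷ʳ b))
  Prev-Next⇒Factor at (p , refl , prev) next = window⇒Factor p (suc (suc l))
    (trans (cong₂ _∷_ (sym prev) (trans (cong₂ _∷ʳ_ at (sym next)) (sym (window-∷ʳ (suc p) l))))
           (sym (window-∷ p (suc l))))

  -- Closure under reversal justifies identifying words with their reversals in the graph: if `b w′`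
  -- occurs, its reversal `w b` is a factor too. `E⁻⇔` and `E⇔` rest on the same argument.
  E⁺⇔ : (E⁺ u w ⊆ λ b → ∃[ j ] Vertex w w′ j b) × (∀ {j} → Vertex w w′ j ⊆ E⁺ u w)
  E⁺⇔ = to , from
    where
    to : E⁺ u w ⊆ λ b → ∃[ j ] Vertex w w′ j b
    to {b} f = let j , eq = Factor⇒window (length-∷ʳ w b) f in j , inj₁ (window-∷ʳ⁻ eq)
    from : ∀ {j} → Vertex w w′ j ⊆ E⁺ u w
    from (inj₁ (at , next)) = Next⇒Factor at next
    from (inj₂ (at , prev)) = subst (Factor u)
      (trans (unfold-reverse _ w′) (cong (_∷ʳ _) (reverse-involutive w))) (closed _ (Prev⇒Factor at prev))

  E⁻⇔ : (E⁻ u w ⊆ λ a → ∃[ j ] Vertex w′ w j a) × (∀ {j} → Vertex w′ w j ⊆ E⁻ u w)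
  E⁻⇔ = to , from
    where
    to : E⁻ u w ⊆ λ a → ∃[ j ] Vertex w′ w j a
    to (p , eq) = let prev , at = window-∷⁻ {p = p} eq in suc p , inj₂ (at , p , refl , prev)
    from : ∀ {j} → Vertex w′ w j ⊆ E⁻ u w
    from (inj₂ (at , prev)) = Prev⇒Factor at prev
    from (inj₁ (at , next)) = subst (Factor u)
      (trans (reverse-∷ʳ w′ _) (cong (_ ∷_) (reverse-involutive w))) (closed _ (Next⇒Factor at next))

  E⇔ : (E u w ⊆ λ e → ∃[ j ] Edge w w′ j e) × (∀ {j} → Edge w w′ j ⊆ E u w)
  E⇔ = to , from
    where
    to : E u w ⊆ λ e → ∃[ j ] Edge w w′ j e
    to {a , b} f =
      let p , eq = Factor⇒window (cong suc (length-∷ʳ w b)) f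
          prev , wb≡ = window-∷⁻ {p = p} eq
          at , next = window-∷ʳ⁻ {j = suc p} wb≡
      in suc p , inj₁ (at , (p , refl , prev) , next)
    from : ∀ {j} → Edge w w′ j ⊆ E u w
    from (inj₁ (at , prev , next)) = Prev-Next⇒Factor at prev next
    from {x = a , b} (inj₂ (at , prev , next)) = subst (Factor u)
      (trans (unfold-reverse b (w′ ∷ʳ a)) (cong (_∷ʳ b)
        (trans (reverse-∷ʳ w′ a) (cong (a ∷_) (reverse-involutive w)))))
      (closed _ (Prev-Next⇒Factor at prev next))

  -- The alphabet is finite, so at some finite stage the scan has met every extension, and the
  -- cardinalities in `m` become those of the traced graph.
  saturated : Factor u w → ∃[ n ] Occurs w w′ n ×
    E⁺ u w ≐ Before (Vertex w w′) n × E⁻ u w ≐ Before (Vertex w′ w) n × E u w ≐ Before (Edge w w′) n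
  saturated (i , at) =
    let n₁ , all₁ = Before-exhausts letters (Vertex w w′)
        n₂ , all₂ = Before-exhausts letters (Vertex w′ w)
        n₃ , all₃ = Before-exhausts pairs (Edge w w′)
        -- The stage exceeds the given occurrence `i` and is at least each of the three exhaustion
        -- stages.
        n = suc i + (n₁ + (n₂ + n₃))
        n₁≤ = ≤-trans (m≤m+n n₁ (n₂ + n₃)) (m≤n+m _ (suc i))
        n₂≤ = ≤-trans (≤-trans (m≤m+n n₂ n₃) (m≤n+m _ n₁)) (m≤n+m _ (suc i))
        n₃≤ = ≤-trans (≤-trans (m≤n+m n₃ n₂) (m≤n+m _ n₁)) (m≤n+m _ (suc i))
    in n , (i , m≤m+n (suc i) _ , inj₁ at) ,
       ((λ f → Before-mono {Q = Vertex w w′} n₁≤ (all₁ (∈-allFin _) (proj₁ E⁺⇔ f))) ,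
        λ (_ , _ , v) → proj₂ E⁺⇔ v) ,
       ((λ f → Before-mono {Q = Vertex w′ w} n₂≤ (all₂ (∈-allFin _) (proj₁ E⁻⇔ f))) ,
        λ (_ , _ , v) → proj₂ E⁻⇔ v) ,
       ((λ f → Before-mono {Q = Edge w w′} n₃≤ (all₃ (∈-pairs _) (proj₁ E⇔ f))) ,
        λ (_ , _ , e) → proj₂ E⇔ e)

  -- This is the tree equation of `bipartite-balance`, read at a stage where the graph is complete.
  m-nonpalindrome : Factor u w → w ≢ reverse w → m em u w ≡ + 0
  m-nonpalindrome factor w≢w′ with saturated factor
  ... | n , occ , E⁺≐ , E⁻≐ , E≐ = begin
    + #e - + #r - + #l ℤ.+ + 1           ≡⟨ regroup (+ #e) (+ #r) (+ #l) ⟩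
    + (#e + 1) - (+ #l ℤ.+ + #r)         ≡⟨ cong (λ z → + z - (+ #l ℤ.+ + #r)) balance ⟩
    (+ #l ℤ.+ + #r) - (+ #l ℤ.+ + #r)    ≡⟨ ℤₚ.+-inverseʳ (+ #l ℤ.+ + #r) ⟩
    + 0                                  ∎
    where
    open ≡-Reasoning
    #e = #E em u w
    #r = #E⁺ em u w
    #l = #E⁻ em u w
    regroup : ∀ e r l → e - r - l ℤ.+ + 1 ≡ e ℤ.+ + 1 - (l ℤ.+ r)
    regroup = ℤ-Solver.solve-∀
    balance : #e + 1 ≡ #l + #r
    balance = trans (cong (_+ 1) (card-cong pairs E≐)) (trans (bipartite-balance refl w≢w′ n occ)
      (sym (cong₂ _+_ (card-cong letters E⁻≐) (card-cong letters E⁺≐))))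

  -- Both extension sets now equal the one vertex set, so twice its size is `#l + #r`, and the loops
  -- are counted by `#d`.
  m-palindrome : Factor u w → w ≡ reverse w → m em u w ≡ + #E⁼ em u w - + 1
  m-palindrome factor w≡ with saturated factor
  ... | n , occ , E⁺≐ , E⁻≐ , E≐ = begin
    + #e - + #r - + #l ℤ.+ + 1                       ≡⟨ regroup (+ #e) (+ #r) (+ #l) ⟩
    + (#e + 2) - + (#l + #r) - + 1                   ≡⟨ cong (λ z → + z - + (#l + #r) - + 1) balance ⟩
    + (#l + #r + #d) - + (#l + #r) - + 1             ≡⟨ cancel (+ (#l + #r)) (+ #d) ⟩
    + #d - + 1                                       ∎
    where
    open ≡-Reasoning
    #e = #E em u w
    #r = #E⁺ em u w
    #l = #E⁻ em u w
    #d = #E⁼ em u w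
    regroup : ∀ e r l → e - r - l ℤ.+ + 1 ≡ e ℤ.+ + 2 - (l ℤ.+ r) - + 1
    regroup = ℤ-Solver.solve-∀
    cancel : ∀ s d → s ℤ.+ d - s - + 1 ≡ d - + 1
    cancel = ℤ-Solver.solve-∀
    balance : #e + 2 ≡ #l + #r + #d
    balance = trans (cong (_+ 2) (card-cong pairs E≐)) (trans
      -- `symmetric-balance` speaks of the pair `w`, `w` and `saturated` of `w`, `w′`: the
      -- occurrence is carried one way along `w≡` and the equation back.
      (subst (λ v → card em pairs (Before (Edge w v) n) + 2 ≡
                    #Before (Vertex v w) n + #Before (Vertex w v) n + card em letters (loop (Before (Edge w v) n)))
        w≡ (symmetric-balance w≡ n (subst (λ v → Occurs w v n) (sym w≡) occ)))
      (sym (cong₂ _+_ (cong₂ _+_ (card-cong letters E⁻≐) (card-cong letters E⁺≐))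
                      (card-cong letters (proj₁ E≐ , proj₂ E≐)))))

theorem21 : (em : ExcludedMiddle 0ℓ) → ∀ {k} (u : InfWord k) →
    ClosedUnderReversal u → FiniteDefect u →
    ∃[ K ] (∀ w → Bispecial em u w → length w ≥ K →
    (w ≢ reverse w → m em u w ≡ + 0) ×
    (w ≡ reverse w → m em u w ≡ + #E⁼ em u w - + 1))
theorem21 em u closed finite =
  -- `N` itself serves as `K`: a block of length at least `N` that has an earlier copy starts at a
  -- positive position and so ends after `N`.
  let N , new = finiteDefect⇒NewPalindrome em u finite in
  N , λ w (factor , _) N≤∣w∣ →
    m-nonpalindrome em {u = u} closed new N≤∣w∣ factor , m-palindrome em {u = u} closed new N≤∣w∣ factor
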